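{- Let $n\ge 1$ and $m\ge 0$ be integers and let $i_1,\dots,i_m\in\{1,\dots,2n\}$. There exists a polynomial $Q\in\mathbb{Q}(q)[y_1,\dots,y_{2n(2n+1)}]$ of total degree at most $m$ such that for all families of nonnegative integers $(\alpha_{i,j})_{1\le i\ne j\le 2n}$, $(\beta_i)_{1\le i\le 2n}$, $(\gamma_i)_{1\le i\le 2n}$, $$\mathbf{D}_{i_1}\circ\cdots\circ\mathbf{D}_{i_m}\big(P(\alpha_{i,j}|\beta_i|\gamma_i)\big)\Big|_{z_1=\cdots=z_{2n}=1}=Q\big((\alpha_{i,j}),(\beta_i),(\gamma_i)\big).$$
   Context: $q$ is a variable. For $1\le k\le 2n$ (with $z_{2n+1}:=z_1$, i.e. the index $2n+1$ is identified with $1$), the linear maps $\mathbf{S}_k,\mathbf{D}_k:\mathbb{Q}(q)[z_1,\dots,z_{2n}]\to\mathbb{Q}(q)[z_1,\dots,z_{2n}]$ are defined as follows: $\mathbf{S}_k(f)$ is $f$ with the variables $z_k$ and $z_{k+1}$ interchanged, and $$\mathbf{D}_k(f)=\frac{qz_k-q^{ -1}z_{k+1}}{z_{k+1}-z_k}\,(\mathbf{S}_k(f)-f).$$ For $1\le i\ne j\le 2n$ put $$f(i,j)=\frac{qz_i-q^{ -1}z_j}{q-q^{ -1}},\qquad g(i)=\frac{q-q^{ -1}z_i}{q-q^{ -1}},\qquad h(i)=\frac{qz_i-q^{ -1}}{q-q^{ -1}},$$ and for nonnegative integers $\alpha_{i,j},\beta_i,\gamma_i$, $$P(\alpha_{i,j}|\beta_i|\gamma_i):=\prod_{1\le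 i\ne j\le 2n}f(i,j)^{\alpha_{i,j}}\prod_{i=1}^{2n}g(i)^{\beta_i}h(i)^{\gamma_i},$$ where the first product runs over all ordered pairs $(i,j)$ with $i\neq j$. The number of parameters $\alpha_{i,j},\beta_i,\gamma_i$ is $2n(2n-1)+2n+2n=2n(2n+1)$. -}

module Defs where

open import Level using (0ℓ)
open import Algebra.Bundles using (CommutativeRing)
open import Data.Bool.Base using (if_then_else_)
open import Data.Empty using (⊥-elim)
open import Data.Fin.Base using (Fin; toℕ)
import Data.Fin.Properties as Fin
open import Data.Fin.Permutation.Components using (transpose)
open import Data.List.Base using (List; []; _∷_; foldr; length)
open import Data.List.Relation.Unary.All using (All)
open import Data.Nat.Base as ℕ using (ℕ; zero; suc)
open import Data.Nat.DivMod using (_mod_)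
open import Data.Product.Base using (Σ-syntax; _×_; _,_)
open import Data.Rational.Base as ℚ using (ℚ; 0ℚ; 1ℚ)
import Data.Rational.Properties as ℚ
open import Data.Sum.Base as Sum using (_⊎_; inj₁; inj₂; [_,_]′)
open import Function.Base using (_∘_)
open import Relation.Binary.PropositionalEquality as ≡ using (_≡_; _≢_)
open import Relation.Nullary using (¬_; Dec; yes; no; does)

import Algebra.Definitions.RawMonoid as RawMonoid
import Algebra.Properties.CommutativeMonoid.Sum as CommutativeMonoidSum
import Algebra.Properties.CommutativeSemigroup as CommutativeSemigroupProperties
import Algebra.Properties.Group as GroupProperties
import Algebra.Properties.Ring as RingProperties
import Algebra.Properties.Semiring.Exp as Exp
import Algebra.Solver.Ring.NaturalCoefficients.Default as CommutativeSemiringSolver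
import Relation.Binary.Reasoning.Setoid as SetoidReasoning

------------------------------------------------------------------------
-- R[x], by lists of coefficients in increasing degree.  Trailing zeros
-- are allowed, so equality is equality of all coefficients.

module Univariate (R : CommutativeRing 0ℓ 0ℓ) where

  private module R = CommutativeRing R
  open R using (Carrier; _≈_; 0#; 1#)

  coeff : List Carrier → ℕ → Carrier
  coeff []      _       = 0#
  coeff (a ∷ _) zero    = a
  coeff (_ ∷ p) (suc n) = coeff p n

  infix 4 _≋_
  record _≋_ (p r : List Carrier) : Set where
    constructor coeffs
    field at : ∀ n → coeff p n ≈ coeff r n
  open _≋_ public

  infixl 6 _⊕_
  infixl 7 _⊗_ _·_

  _⊕_ : List Carrier → List Carrier → List Carrier
  []      ⊕ r       = r
  (a ∷ p) ⊕ []      = a ∷ p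
  (a ∷ p) ⊕ (b ∷ r) = (a R.+ b) ∷ (p ⊕ r)

  _·_ : Carrier → List Carrier → List Carrier
  c · []      = []
  c · (a ∷ p) = (c R.* a) ∷ (c · p)

  ⊖_ : List Carrier → List Carrier
  ⊖ []      = []
  ⊖ (a ∷ p) = (R.- a) ∷ (⊖ p)

  _⊗_ : List Carrier → List Carrier → List Carrier
  []      ⊗ r = []
  (a ∷ p) ⊗ r = (a · r) ⊕ (0# ∷ (p ⊗ r))

  private
    ≋-refl : ∀ {p} → p ≋ p
    ≋-refl = coeffs λ _ → R.refl

    ≋-sym : ∀ {p r} → p ≋ r → r ≋ p
    ≋-sym e = coeffs λ n → R.sym (at e n)

    ≋-trans : ∀ {p r s} → p ≋ r → r ≋ s → p ≋ s
    ≋-trans e f = coeffs λ n → R.trans (at e n) (at f n)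

    ∷-cong : ∀ {a b p r} → a ≈ b → p ≋ r → (a ∷ p) ≋ (b ∷ r)
    ∷-cong a≈b e = coeffs λ { zero → a≈b ; (suc n) → at e n }

    0∷[]≋[] : ∀ {a} → a ≈ 0# → (a ∷ []) ≋ []
    0∷[]≋[] a≈0 = coeffs λ { zero → a≈0 ; (suc n) → R.refl }

    coeff-⊕ : ∀ p r n → coeff (p ⊕ r) n ≈ coeff p n R.+ coeff r n
    coeff-⊕ []      r       n       = R.sym (R.+-identityˡ _)
    coeff-⊕ (a ∷ p) []      n       = R.sym (R.+-identityʳ _)
    coeff-⊕ (a ∷ p) (b ∷ r) zero    = R.refl
    coeff-⊕ (a ∷ p) (b ∷ r) (suc n) = coeff-⊕ p r n

    coeff-· : ∀ c p n → coeff (c · p) n ≈ c R.* coeff p n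
    coeff-· c []      n       = R.sym (R.zeroʳ c)
    coeff-· c (a ∷ p) zero    = R.refl
    coeff-· c (a ∷ p) (suc n) = coeff-· c p n

    coeff-⊖ : ∀ p n → coeff (⊖ p) n ≈ R.- coeff p n
    coeff-⊖ []      n       = R.sym (RingProperties.-0#≈0# R.ring)
    coeff-⊖ (a ∷ p) zero    = R.refl
    coeff-⊖ (a ∷ p) (suc n) = coeff-⊖ p n

    ⊕-cong : ∀ {p p′ r r′} → p ≋ p′ → r ≋ r′ → p ⊕ r ≋ p′ ⊕ r′
    ⊕-cong {p} {p′} {r} {r′} e f = coeffs λ n → R.trans (coeff-⊕ p r n)
      (R.trans (R.+-cong (at e n) (at f n)) (R.sym (coeff-⊕ p′ r′ n)))

    ⊕-comm : ∀ p r → p ⊕ r ≋ r ⊕ p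
    ⊕-comm p r = coeffs λ n → R.trans (coeff-⊕ p r n)
      (R.trans (R.+-comm _ _) (R.sym (coeff-⊕ r p n)))

    ⊕-assoc : ∀ p r s → (p ⊕ r) ⊕ s ≋ p ⊕ (r ⊕ s)
    ⊕-assoc p r s = coeffs λ n →
      R.trans (coeff-⊕ (p ⊕ r) s n) (R.trans (R.+-congʳ (coeff-⊕ p r n))
      (R.trans (R.+-assoc _ _ _) (R.trans (R.+-congˡ (R.sym (coeff-⊕ r s n)))
      (R.sym (coeff-⊕ p (r ⊕ s) n)))))

    ⊕-identityʳ : ∀ p → p ⊕ [] ≋ p
    ⊕-identityʳ p = ⊕-comm p []

    ⊖-inverseˡ : ∀ p → (⊖ p) ⊕ p ≋ []
    ⊖-inverseˡ p = coeffs λ n → R.trans (coeff-⊕ (⊖ p) p n)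
      (R.trans (R.+-congʳ (coeff-⊖ p n)) (R.-‿inverseˡ _))

    ⊖-cong : ∀ {p r} → p ≋ r → ⊖ p ≋ ⊖ r
    ⊖-cong {p} {r} e = coeffs λ n → R.trans (coeff-⊖ p n)
      (R.trans (R.-‿cong (at e n)) (R.sym (coeff-⊖ r n)))

    ⊕-swap : ∀ p r s → p ⊕ (r ⊕ s) ≋ r ⊕ (p ⊕ s)
    ⊕-swap p r s = ≋-trans (≋-sym (⊕-assoc p r s))
      (≋-trans (⊕-cong (⊕-comm p r) ≋-refl) (⊕-assoc r p s))

    ⊕-interchange : ∀ p r s t → (p ⊕ r) ⊕ (s ⊕ t) ≋ (p ⊕ s) ⊕ (r ⊕ t)
    ⊕-interchange p r s t = ≋-trans (⊕-assoc p r (s ⊕ t))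
      (≋-trans (⊕-cong (≋-refl {p}) (⊕-swap r s t)) (≋-sym (⊕-assoc p s (r ⊕ t))))

    ·-cong : ∀ {a b p r} → a ≈ b → p ≋ r → a · p ≋ b · r
    ·-cong {a} {b} {p} {r} a≈b e = coeffs λ n → R.trans (coeff-· a p n)
      (R.trans (R.*-cong a≈b (at e n)) (R.sym (coeff-· b r n)))

    ·-distribˡ : ∀ c p r → c · (p ⊕ r) ≋ c · p ⊕ c · r
    ·-distribˡ c p r = coeffs λ n →
      R.trans (coeff-· c (p ⊕ r) n) (R.trans (R.*-congˡ (coeff-⊕ p r n))
      (R.trans (R.distribˡ _ _ _)
      (R.trans (R.+-cong (R.sym (coeff-· c p n)) (R.sym (coeff-· c r n)))
      (R.sym (coeff-⊕ (c · p) (c · r) n)))))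

    ·-assoc : ∀ a b p → (a R.* b) · p ≋ a · (b · p)
    ·-assoc a b p = coeffs λ n → R.trans (coeff-· (a R.* b) p n)
      (R.trans (R.*-assoc _ _ _) (R.trans (R.*-congˡ (R.sym (coeff-· b p n)))
      (R.sym (coeff-· a (b · p) n))))

    0·p≋[] : ∀ {c} p → c ≈ 0# → c · p ≋ []
    0·p≋[] {c} p c≈0 = coeffs λ n →
      R.trans (coeff-· c p n) (R.trans (R.*-congʳ c≈0) (R.zeroˡ _))

    1·p≋p : ∀ p → 1# · p ≋ p
    1·p≋p p = coeffs λ n → R.trans (coeff-· 1# p n) (R.*-identityˡ _)

    0∷-⊕ : ∀ p r → (0# ∷ (p ⊕ r)) ≋ (0# ∷ p) ⊕ (0# ∷ r)
    0∷-⊕ p r = ∷-cong (R.sym (R.+-identityˡ 0#)) ≋-refl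

    0∷-⊗ : ∀ {a} p r → a ≈ 0# → (a ∷ p) ⊗ r ≋ (0# ∷ (p ⊗ r))
    0∷-⊗ p r a≈0 = ⊕-cong (0·p≋[] r a≈0) ≋-refl

    ⊗-zeroʳ : ∀ p → p ⊗ [] ≋ []
    ⊗-zeroʳ []      = ≋-refl
    ⊗-zeroʳ (a ∷ p) = ≋-trans (∷-cong R.refl (⊗-zeroʳ p)) (0∷[]≋[] R.refl)

    ⊗-∷ : ∀ p b r → p ⊗ (b ∷ r) ≋ b · p ⊕ (0# ∷ (p ⊗ r))
    ⊗-∷ []      b r = ≋-sym (0∷[]≋[] R.refl)
    ⊗-∷ (a ∷ p) b r = ∷-cong (R.+-congʳ (R.*-comm a b))
      (≋-trans (⊕-cong (≋-refl {a · r}) (⊗-∷ p b r))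
               (⊕-swap (a · r) (b · p) (0# ∷ (p ⊗ r))))

    ⊗-comm : ∀ p r → p ⊗ r ≋ r ⊗ p
    ⊗-comm []      r = ≋-sym (⊗-zeroʳ r)
    ⊗-comm (a ∷ p) r = ≋-trans
      (⊕-cong (≋-refl {a · r}) (∷-cong R.refl (⊗-comm p r))) (≋-sym (⊗-∷ r a p))

    ⊗-congˡ : ∀ p {r s} → r ≋ s → p ⊗ r ≋ p ⊗ s
    ⊗-congˡ []      e = ≋-refl
    ⊗-congˡ (a ∷ p) e = ⊕-cong (·-cong R.refl e) (∷-cong R.refl (⊗-congˡ p e))

    ⊗-cong : ∀ {p p′ r r′} → p ≋ p′ → r ≋ r′ → p ⊗ r ≋ p′ ⊗ r′
    ⊗-cong {p} {p′} {r} {r′} e f = ≋-trans (⊗-congˡ p f)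
      (≋-trans (⊗-comm p r′) (≋-trans (⊗-congˡ r′ e) (⊗-comm r′ p′)))

    ⊗-distribˡ : ∀ s p r → s ⊗ (p ⊕ r) ≋ s ⊗ p ⊕ s ⊗ r
    ⊗-distribˡ []      p r = ≋-refl
    ⊗-distribˡ (a ∷ s) p r = ≋-trans
      (⊕-cong (·-distribˡ a p r)
        (≋-trans (∷-cong R.refl (⊗-distribˡ s p r)) (0∷-⊕ (s ⊗ p) (s ⊗ r))))
      (⊕-interchange (a · p) (a · r) (0# ∷ (s ⊗ p)) (0# ∷ (s ⊗ r)))

    ⊗-distribʳ : ∀ s p r → (p ⊕ r) ⊗ s ≋ p ⊗ s ⊕ r ⊗ s
    ⊗-distribʳ s p r = ≋-trans (⊗-comm (p ⊕ r) s)
      (≋-trans (⊗-distribˡ s p r) (⊕-cong (⊗-comm s p) (⊗-comm s r)))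

    ·-⊗ : ∀ c p r → (c · p) ⊗ r ≋ c · (p ⊗ r)
    ·-⊗ c []      r = ≋-refl
    ·-⊗ c (a ∷ p) r = ≋-trans
      (⊕-cong (·-assoc c a r) (∷-cong (R.sym (R.zeroʳ c)) (·-⊗ c p r)))
      (≋-sym (·-distribˡ c (a · r) (0# ∷ (p ⊗ r))))

    ⊗-assoc : ∀ p r s → (p ⊗ r) ⊗ s ≋ p ⊗ (r ⊗ s)
    ⊗-assoc []      r s = ≋-refl
    ⊗-assoc (a ∷ p) r s = ≋-trans (⊗-distribʳ s (a · r) (0# ∷ (p ⊗ r)))
      (⊕-cong (·-⊗ a r s)
        (≋-trans (0∷-⊗ (p ⊗ r) s R.refl) (∷-cong R.refl (⊗-assoc p r s))))

    ⊗-identityˡ : ∀ p → (1# ∷ []) ⊗ p ≋ p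
    ⊗-identityˡ p = ≋-trans (⊕-cong (1·p≋p p) (0∷[]≋[] R.refl)) (⊕-identityʳ p)

  commutativeRing : CommutativeRing 0ℓ 0ℓ
  commutativeRing = record
    { Carrier = List Carrier
    ; _≈_ = _≋_ ; _+_ = _⊕_ ; _*_ = _⊗_ ; -_ = ⊖_ ; 0# = [] ; 1# = 1# ∷ []
    ; isCommutativeRing = record
      { isRing = record
        { +-isAbelianGroup = record
          { isGroup = record
            { isMonoid = record
              { isSemigroup = record
                { isMagma = record
                  { isEquivalence = record
                    { refl = ≋-refl ; sym = ≋-sym ; trans = ≋-trans }
                  ; ∙-cong = ⊕-cong }
                ; assoc = ⊕-assoc }
              ; identity = (λ _ → ≋-refl) , ⊕-identityʳ }
            ; inverse = ⊖-inverseˡ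
                      , λ p → ≋-trans (⊕-comm p (⊖ p)) (⊖-inverseˡ p)
            ; ⁻¹-cong = ⊖-cong }
          ; comm = ⊕-comm }
        ; *-cong = ⊗-cong
        ; *-assoc = ⊗-assoc
        ; *-identity = ⊗-identityˡ
                     , λ p → ≋-trans (⊗-comm p (1# ∷ [])) (⊗-identityˡ p)
        ; distrib = ⊗-distribˡ , ⊗-distribʳ }
      ; *-comm = ⊗-comm } }

  module _ (_≈0? : ∀ a → Dec (a ≈ 0#))
           (R-integral : ∀ a b → a R.* b ≈ 0# → a ≈ 0# ⊎ b ≈ 0#) where

    private
      ∷≋[] : ∀ {a p} → a ≈ 0# → p ≋ [] → (a ∷ p) ≋ []
      ∷≋[] a≈0 e = coeffs λ { zero → a≈0 ; (suc n) → at e n }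

      tail≋[] : ∀ {a p} → (a ∷ p) ≋ [] → p ≋ []
      tail≋[] e = coeffs λ n → at e (suc n)

      NoZeroDivisor : List Carrier → Set
      NoZeroDivisor p = ∀ r → p ⊗ r ≋ [] → p ≋ [] ⊎ r ≋ []

      lead≈0 : ∀ {a p} → a ≈ 0# → NoZeroDivisor p → NoZeroDivisor (a ∷ p)
      lead≈0 {p = p} a≈0 ih r e = Sum.map₁ (∷≋[] a≈0) (ih r
        (tail≋[] (≋-trans (≋-sym (0∷-⊗ p r a≈0)) e)))

      lead≉0 : ∀ {a} p → ¬ (a ≈ 0#) → NoZeroDivisor (a ∷ p)
      lead≉0     p a≉0 []      e = inj₂ ≋-refl
      lead≉0 {a} p a≉0 (b ∷ r) e with b ≈0?
      ... | yes b≈0 = Sum.map₂ (∷≋[] b≈0) (lead≉0 p a≉0 r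
              (tail≋[] (≋-trans (≋-sym (≋-trans (⊗-∷ (a ∷ p) b r)
                (⊕-cong (0·p≋[] (a ∷ p) b≈0) ≋-refl))) e)))
      ... | no b≉0 = ⊥-elim ([ a≉0 , b≉0 ]′ (R-integral a b
              (R.trans (R.sym (R.+-identityʳ _)) (at e 0))))

    integral : ∀ p r → p ⊗ r ≋ [] → p ≋ [] ⊎ r ≋ []
    integral []      r e = inj₁ ≋-refl
    integral (a ∷ p) with a ≈0?
    ... | yes a≈0 = lead≈0 a≈0 (integral p)
    ... | no  a≉0 = lead≉0 p a≉0

------------------------------------------------------------------------
-- The field of fractions of an integral domain

module FractionField
  (R : CommutativeRing 0ℓ 0ℓ)
  (1≉0 : ¬ (CommutativeRing._≈_ R (CommutativeRing.1# R) (CommutativeRing.0# R)))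
  (integral : ∀ a b →
    CommutativeRing._≈_ R (CommutativeRing._*_ R a b) (CommutativeRing.0# R) →
    CommutativeRing._≈_ R a (CommutativeRing.0# R) ⊎
    CommutativeRing._≈_ R b (CommutativeRing.0# R))
  where

  open CommutativeRing R

  private module S = CommutativeSemiringSolver commutativeSemiring
  open S using (solve; _:=_; _:+_; _:*_)

  record Fraction : Set where
    constructor fraction
    field
      num   : Carrier
      den   : Carrier
      den≉0 : ¬ (den ≈ 0#)
  open Fraction public

  infix 4 _≃_
  record _≃_ (x y : Fraction) : Set where
    constructor cross
    field uncross : num x * den y ≈ num y * den x
  open _≃_ public

  private
    *-≉0 : ∀ {a b} → ¬ (a ≈ 0#) → ¬ (b ≈ 0#) → ¬ (a * b ≈ 0#)
    *-≉0 a≉0 b≉0 e = [ a≉0 , b≉0 ]′ (integral _ _ e)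

    cancelʳ : ∀ {a b c} → ¬ (c ≈ 0#) → a * c ≈ b * c → a ≈ b
    cancelʳ {a} {b} {c} c≉0 e = [ x∙y⁻¹≈ε⇒x≈y a b , ⊥-elim ∘ c≉0 ]′
      (integral (a - b) c (trans (distribʳ c a (- b))
        (trans (+-congˡ (sym (-‿distribˡ-* b c))) (x≈y⇒x∙y⁻¹≈ε e))))
      where
      open RingProperties ring using (-‿distribˡ-*)
      open GroupProperties +-group using (x∙y⁻¹≈ε⇒x≈y; x≈y⇒x∙y⁻¹≈ε)

  ι : Carrier → Fraction
  ι a = fraction a 1# 1≉0

  infixl 6 _⊕_
  infixl 7 _⊗_

  _⊕_ : Fraction → Fraction → Fraction
  fraction a b b≉0 ⊕ fraction c d d≉0 =
    fraction (a * d + c * b) (b * d) (*-≉0 b≉0 d≉0)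

  _⊗_ : Fraction → Fraction → Fraction
  fraction a b b≉0 ⊗ fraction c d d≉0 = fraction (a * c) (b * d) (*-≉0 b≉0 d≉0)

  ⊖_ : Fraction → Fraction
  ⊖ fraction a b b≉0 = fraction (- a) b b≉0

  private
    ≃-refl : ∀ {x} → x ≃ x
    ≃-refl = cross refl

    ≃-sym : ∀ {x y} → x ≃ y → y ≃ x
    ≃-sym (cross e) = cross (sym e)

    ≃-trans : ∀ {x y z} → x ≃ y → y ≃ z → x ≃ z
    ≃-trans {fraction a b _} {fraction c d d≉0} {fraction e f _} (cross p) (cross r) =
      cross (cancelʳ d≉0 (begin
        (a * f) * d ≈⟨ swapʳ a f d ⟩
        (a * d) * f ≈⟨ *-congʳ p ⟩
        (c * b) * f ≈⟨ swapʳ c b f ⟩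
        (c * f) * b ≈⟨ *-congʳ r ⟩
        (e * d) * b ≈⟨ swapʳ e d b ⟩
        (e * b) * d ∎))
      where
      open SetoidReasoning setoid
      swapʳ : ∀ x y z → (x * y) * z ≈ (x * z) * y
      swapʳ = solve 3 (λ x y z → (x :* y) :* z := (x :* z) :* y) refl

    ⊕-cong : ∀ {x x′ y y′} → x ≃ x′ → y ≃ y′ → x ⊕ y ≃ x′ ⊕ y′
    ⊕-cong {fraction a b _} {fraction a′ b′ _} {fraction c d _} {fraction c′ d′ _}
      (cross p) (cross r) = cross (begin
        (a * d + c * b) * (b′ * d′)           ≈⟨ shuffle a b c d b′ d′ ⟩
        (a * b′) * (d * d′) + (c * d′) * (b * b′)
          ≈⟨ +-cong (*-congʳ p) (*-congʳ r) ⟩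
        (a′ * b) * (d * d′) + (c′ * d) * (b * b′)
          ≈⟨ unshuffle a′ b c′ d b′ d′ ⟩
        (a′ * d′ + c′ * b′) * (b * d)         ∎)
      where
      open SetoidReasoning setoid
      shuffle : ∀ a b c d b′ d′ → (a * d + c * b) * (b′ * d′)
                ≈ (a * b′) * (d * d′) + (c * d′) * (b * b′)
      shuffle = solve 6 (λ a b c d b′ d′ → (a :* d :+ c :* b) :* (b′ :* d′)
        := (a :* b′) :* (d :* d′) :+ (c :* d′) :* (b :* b′)) refl
      unshuffle : ∀ a b c d b′ d′ → (a * b) * (d * d′) + (c * d) * (b * b′)
                  ≈ (a * d′ + c * b′) * (b * d)
      unshuffle = solve 6 (λ a b c d b′ d′ →
        (a :* b) :* (d :* d′) :+ (c :* d) :* (b :* b′)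
        := (a :* d′ :+ c :* b′) :* (b :* d)) refl

    ⊗-cong : ∀ {x x′ y y′} → x ≃ x′ → y ≃ y′ → x ⊗ y ≃ x′ ⊗ y′
    ⊗-cong {fraction a b _} {fraction a′ b′ _} {fraction c d _} {fraction c′ d′ _}
      (cross p) (cross r) = cross (begin
        (a * c) * (b′ * d′)  ≈⟨ interchange a c b′ d′ ⟩
        (a * b′) * (c * d′)  ≈⟨ *-cong p r ⟩
        (a′ * b) * (c′ * d)  ≈⟨ interchange a′ b c′ d ⟩
        (a′ * c′) * (b * d)  ∎)
      where
      open SetoidReasoning setoid
      interchange : ∀ x y z w → (x * y) * (z * w) ≈ (x * z) * (y * w)
      interchange = solve 4 (λ x y z w →
        (x :* y) :* (z :* w) := (x :* z) :* (y :* w)) refl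

    ⊖-cong : ∀ {x y} → x ≃ y → ⊖ x ≃ ⊖ y
    ⊖-cong {fraction a b _} {fraction c d _} (cross p) = cross
      (trans (sym (-‿distribˡ-* a d)) (trans (-‿cong p) (-‿distribˡ-* c b)))
      where open RingProperties ring using (-‿distribˡ-*)

    ⊕-comm : ∀ x y → x ⊕ y ≃ y ⊕ x
    ⊕-comm (fraction a b _) (fraction c d _) = cross (solve 4 (λ a b c d →
      (a :* d :+ c :* b) :* (d :* b) := (c :* b :+ a :* d) :* (b :* d)) refl a b c d)

    ⊕-assoc : ∀ x y z → (x ⊕ y) ⊕ z ≃ x ⊕ (y ⊕ z)
    ⊕-assoc (fraction a b _) (fraction c d _) (fraction e f _) = cross
      (solve 6 (λ a b c d e f →
        ((a :* d :+ c :* b) :* f :+ e :* (b :* d)) :* (b :* (d :* f))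
        := (a :* (d :* f) :+ (c :* f :+ e :* d) :* b) :* ((b :* d) :* f))
        refl a b c d e f)

    ⊕-identityˡ : ∀ x → ι 0# ⊕ x ≃ x
    ⊕-identityˡ (fraction a b _) = cross (solve 2 (λ a b →
      (S.con 0 :* b :+ a :* S.con 1) :* b := a :* (S.con 1 :* b)) refl a b)

    ⊖-inverseˡ : ∀ x → (⊖ x) ⊕ x ≃ ι 0#
    ⊖-inverseˡ (fraction a b _) = cross (trans (*-identityʳ _)
      (trans (sym (distribʳ b (- a) a))
      (trans (*-congʳ (-‿inverseˡ a)) (trans (zeroˡ b) (sym (zeroˡ _))))))

    ⊗-comm : ∀ x y → x ⊗ y ≃ y ⊗ x
    ⊗-comm (fraction a b _) (fraction c d _) =
      cross (*-cong (*-comm a c) (*-comm d b))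

    ⊗-assoc : ∀ x y z → (x ⊗ y) ⊗ z ≃ x ⊗ (y ⊗ z)
    ⊗-assoc (fraction a b _) (fraction c d _) (fraction e f _) =
      cross (*-cong (*-assoc a c e) (sym (*-assoc b d f)))

    ⊗-identityˡ : ∀ x → ι 1# ⊗ x ≃ x
    ⊗-identityˡ (fraction a b _) =
      cross (trans (*-congʳ (*-identityˡ a)) (*-congˡ (sym (*-identityˡ b))))

    ⊗-distribˡ : ∀ x y z → x ⊗ (y ⊕ z) ≃ x ⊗ y ⊕ x ⊗ z
    ⊗-distribˡ (fraction a b _) (fraction c d _) (fraction e f _) = cross
      (solve 6 (λ a b c d e f →
        (a :* (c :* f :+ e :* d)) :* ((b :* d) :* (b :* f))
        := ((a :* c) :* (b :* f) :+ (a :* e) :* (b :* d)) :* (b :* (d :* f)))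
        refl a b c d e f)

  commutativeRing : CommutativeRing 0ℓ 0ℓ
  commutativeRing = record
    { Carrier = Fraction
    ; _≈_ = _≃_ ; _+_ = _⊕_ ; _*_ = _⊗_ ; -_ = ⊖_ ; 0# = ι 0# ; 1# = ι 1#
    ; isCommutativeRing = record
      { isRing = record
        { +-isAbelianGroup = record
          { isGroup = record
            { isMonoid = record
              { isSemigroup = record
                { isMagma = record
                  { isEquivalence = record
                    { refl = ≃-refl ; sym = ≃-sym ; trans = ≃-trans }
                  ; ∙-cong = ⊕-cong }
                ; assoc = ⊕-assoc }
              ; identity = ⊕-identityˡ
                         , λ x → ≃-trans (⊕-comm x (ι 0#)) (⊕-identityˡ x) }
            ; inverse = ⊖-inverseˡ
                      , λ x → ≃-trans (⊕-comm x (⊖ x)) (⊖-inverseˡ x)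
            ; ⁻¹-cong = ⊖-cong }
          ; comm = ⊕-comm }
        ; *-cong = ⊗-cong
        ; *-assoc = ⊗-assoc
        ; *-identity = ⊗-identityˡ
                     , λ x → ≃-trans (⊗-comm x (ι 1#)) (⊗-identityˡ x)
        ; distrib = ⊗-distribˡ
                  , λ x y z → ≃-trans (⊗-comm (y ⊕ z) x)
                      (≃-trans (⊗-distribˡ x y z) (⊕-cong (⊗-comm x y) (⊗-comm x z))) }
      ; *-comm = ⊗-comm } }

  recip : (x : Fraction) → ¬ (x ≃ ι 0#) → Fraction
  recip x x≄0 = fraction (den x) (num x)
    λ e → x≄0 (cross (trans (*-identityʳ _) (trans e (sym (zeroˡ _)))))

  recip-inverse : ∀ x (x≄0 : ¬ (x ≃ ι 0#)) → x ⊗ recip x x≄0 ≃ ι 1#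
  recip-inverse (fraction a b _) _ = cross
    (trans (*-identityʳ _) (trans (*-comm a b) (sym (*-identityˡ _))))

------------------------------------------------------------------------
-- The polynomial ring R[X] in a set X of variables, as the free
-- commutative R-algebra on X: ring expressions modulo the least
-- congruence that makes them a commutative R-algebra.

module Multivariate (R : CommutativeRing 0ℓ 0ℓ) where

  private module R = CommutativeRing R

  infix  8 ⊖_
  infixl 7 _⊗_
  infixl 6 _⊕_
  infix  4 _≋_

  data Poly (X : Set) : Set where
    con     : R.Carrier → Poly X
    var     : X → Poly X
    _⊕_ _⊗_ : Poly X → Poly X → Poly X
    ⊖_      : Poly X → Poly X

  data _≋_ {X : Set} : Poly X → Poly X → Set where
    ≋-refl      : ∀ {f} → f ≋ f
    ≋-sym       : ∀ {f g} → f ≋ g → g ≋ f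
    ≋-trans     : ∀ {f g h} → f ≋ g → g ≋ h → f ≋ h
    ⊕-cong      : ∀ {f f′ g g′} → f ≋ f′ → g ≋ g′ → f ⊕ g ≋ f′ ⊕ g′
    ⊗-cong      : ∀ {f f′ g g′} → f ≋ f′ → g ≋ g′ → f ⊗ g ≋ f′ ⊗ g′
    ⊖-cong      : ∀ {f g} → f ≋ g → ⊖ f ≋ ⊖ g
    con-cong    : ∀ {a b} → a R.≈ b → con a ≋ con b
    con-+       : ∀ a b → con (a R.+ b) ≋ con a ⊕ con b
    con-*       : ∀ a b → con (a R.* b) ≋ con a ⊗ con b
    ⊕-assoc     : ∀ f g h → (f ⊕ g) ⊕ h ≋ f ⊕ (g ⊕ h)
    ⊕-comm      : ∀ f g → f ⊕ g ≋ g ⊕ f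
    ⊕-identityˡ : ∀ f → con R.0# ⊕ f ≋ f
    ⊖-inverseˡ  : ∀ f → ⊖ f ⊕ f ≋ con R.0#
    ⊗-assoc     : ∀ f g h → (f ⊗ g) ⊗ h ≋ f ⊗ (g ⊗ h)
    ⊗-comm      : ∀ f g → f ⊗ g ≋ g ⊗ f
    ⊗-identityˡ : ∀ f → con R.1# ⊗ f ≋ f
    ⊗-distribˡ  : ∀ f g h → f ⊗ (g ⊕ h) ≋ f ⊗ g ⊕ f ⊗ h

  poly-ring : Set → CommutativeRing 0ℓ 0ℓ
  poly-ring X = record
    { Carrier = Poly X
    ; _≈_ = _≋_ ; _+_ = _⊕_ ; _*_ = _⊗_ ; -_ = ⊖_
    ; 0# = con R.0# ; 1# = con R.1#
    ; isCommutativeRing = record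
      { isRing = record
        { +-isAbelianGroup = record
          { isGroup = record
            { isMonoid = record
              { isSemigroup = record
                { isMagma = record
                  { isEquivalence = record
                    { refl = ≋-refl ; sym = ≋-sym ; trans = ≋-trans }
                  ; ∙-cong = ⊕-cong }
                ; assoc = ⊕-assoc }
              ; identity = ⊕-identityˡ
                         , λ f → ≋-trans (⊕-comm f (con R.0#)) (⊕-identityˡ f) }
            ; inverse = ⊖-inverseˡ
                      , λ f → ≋-trans (⊕-comm f (⊖ f)) (⊖-inverseˡ f)
            ; ⁻¹-cong = ⊖-cong }
          ; comm = ⊕-comm }
        ; *-cong = ⊗-cong
        ; *-assoc = ⊗-assoc
        ; *-identity = ⊗-identityˡ
                     , λ f → ≋-trans (⊗-comm f (con R.1#)) (⊗-identityˡ f)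
        ; distrib = ⊗-distribˡ
                  , λ f g h → ≋-trans (⊗-comm (g ⊕ h) f)
                      (≋-trans (⊗-distribˡ f g h) (⊕-cong (⊗-comm f g) (⊗-comm f h))) }
      ; *-comm = ⊗-comm } }

  eval : ∀ {X} → (X → R.Carrier) → Poly X → R.Carrier
  eval ρ (con a) = a
  eval ρ (var x) = ρ x
  eval ρ (f ⊕ g) = eval ρ f R.+ eval ρ g
  eval ρ (f ⊗ g) = eval ρ f R.* eval ρ g
  eval ρ (⊖ f)   = R.- eval ρ f

  eval-cong : ∀ {X} (ρ : X → R.Carrier) {f g} → f ≋ g → eval ρ f R.≈ eval ρ g
  eval-cong ρ ≋-refl             = R.refl
  eval-cong ρ (≋-sym e)          = R.sym (eval-cong ρ e)
  eval-cong ρ (≋-trans e e′)     = R.trans (eval-cong ρ e) (eval-cong ρ e′)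
  eval-cong ρ (⊕-cong e e′)      = R.+-cong (eval-cong ρ e) (eval-cong ρ e′)
  eval-cong ρ (⊗-cong e e′)      = R.*-cong (eval-cong ρ e) (eval-cong ρ e′)
  eval-cong ρ (⊖-cong e)         = R.-‿cong (eval-cong ρ e)
  eval-cong ρ (con-cong e)       = e
  eval-cong ρ (con-+ a b)        = R.refl
  eval-cong ρ (con-* a b)        = R.refl
  eval-cong ρ (⊕-assoc f g h)    = R.+-assoc _ _ _
  eval-cong ρ (⊕-comm f g)       = R.+-comm _ _
  eval-cong ρ (⊕-identityˡ f)    = R.+-identityˡ _
  eval-cong ρ (⊖-inverseˡ f)     = R.-‿inverseˡ _
  eval-cong ρ (⊗-assoc f g h)    = R.*-assoc _ _ _
  eval-cong ρ (⊗-comm f g)       = R.*-comm _ _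
  eval-cong ρ (⊗-identityˡ f)    = R.*-identityˡ _
  eval-cong ρ (⊗-distribˡ f g h) = R.distribˡ _ _ _

  rename : ∀ {X Y} → (X → Y) → Poly X → Poly Y
  rename σ (con a) = con a
  rename σ (var x) = var (σ x)
  rename σ (f ⊕ g) = rename σ f ⊕ rename σ g
  rename σ (f ⊗ g) = rename σ f ⊗ rename σ g
  rename σ (⊖ f)   = ⊖ rename σ f

  rename-cong : ∀ {X Y} (σ : X → Y) {f g} → f ≋ g → rename σ f ≋ rename σ g
  rename-cong σ ≋-refl             = ≋-refl
  rename-cong σ (≋-sym e)          = ≋-sym (rename-cong σ e)
  rename-cong σ (≋-trans e e′)     = ≋-trans (rename-cong σ e) (rename-cong σ e′)
  rename-cong σ (⊕-cong e e′)      = ⊕-cong (rename-cong σ e) (rename-cong σ e′)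
  rename-cong σ (⊗-cong e e′)      = ⊗-cong (rename-cong σ e) (rename-cong σ e′)
  rename-cong σ (⊖-cong e)         = ⊖-cong (rename-cong σ e)
  rename-cong σ (con-cong e)       = con-cong e
  rename-cong σ (con-+ a b)        = con-+ a b
  rename-cong σ (con-* a b)        = con-* a b
  rename-cong σ (⊕-assoc f g h)    = ⊕-assoc _ _ _
  rename-cong σ (⊕-comm f g)       = ⊕-comm _ _
  rename-cong σ (⊕-identityˡ f)    = ⊕-identityˡ _
  rename-cong σ (⊖-inverseˡ f)     = ⊖-inverseˡ _
  rename-cong σ (⊗-assoc f g h)    = ⊗-assoc _ _ _
  rename-cong σ (⊗-comm f g)       = ⊗-comm _ _
  rename-cong σ (⊗-identityˡ f)    = ⊗-identityˡ _
  rename-cong σ (⊗-distribˡ f g h) = ⊗-distribˡ _ _ _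

  -- A monomial is the list of its variables with multiplicity, so its
  -- total degree is the length of the list.
  monomial : ∀ {X} → List X → Poly X
  monomial = foldr (λ x f → var x ⊗ f) (con R.1#)

  combination : ∀ {X} → List (R.Carrier × List X) → Poly X
  combination = foldr (λ { (a , xs) f → con a ⊗ monomial xs ⊕ f }) (con R.0#)

  TotalDegree≤ : ∀ {X} → ℕ → Poly X → Set
  TotalDegree≤ {X} d f = Σ[ ts ∈ List (R.Carrier × List X) ]
    (All (λ { (_ , xs) → length xs ℕ.≤ d }) ts × f ≋ combination ts)

------------------------------------------------------------------------
-- Index sets.  Indices are shifted from 1,…,N to 0,…,N-1.

next : ∀ {N} → Fin N → Fin N
next {suc N} k = suc (toℕ k) mod suc N

record OffDiagonal (N : ℕ) : Set where
  constructor pair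
  field
    row col  : Fin N
    .row≢col : row ≢ col

-- The N (N - 1) + N + N = N (N + 1) parameters, which index the
-- variables of Q.
Parameter : ℕ → Set
Parameter N = OffDiagonal N ⊎ Fin N ⊎ Fin N

------------------------------------------------------------------------
-- The operators S_k and D_k and the products P(α|β|γ), over any ring K
-- with elements q, q⁻¹ and 1/[q-q⁻¹].  They are used only for K = ℚ(q),
-- but type checking is faster for a variable K.

module Operators
  (K : CommutativeRing 0ℓ 0ℓ)
  (q q⁻¹ 1/[q-q⁻¹] : CommutativeRing.Carrier K)
  where

  private module K = CommutativeRing K
  open Multivariate K

  private
    module Ring {X : Set} = CommutativeRing (poly-ring X)
    open module ExpOps {X : Set} = Exp (Ring.semiring {X}) using (_^_)
    open module ProdOps {X : Set} =
      CommutativeMonoidSum (Ring.*-commutativeMonoid {X}) using () renaming (sum to ∏)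

  open Ring using () renaming (_-_ to infixl 6 _⊝_)

  fromℕ : ℕ → K.Carrier
  fromℕ n = n · K.1#
    where open RawMonoid K.+-rawMonoid using () renaming (_×_ to _·_)

  Polyz : ℕ → Set
  Polyz N = Poly (Fin N)

  z : ∀ {N} → Fin N → Polyz N
  z = var

  S : ∀ {N} → Fin N → Polyz N → Polyz N
  S k = rename (transpose k (next k))

  -- The quotient (S k f - f) / (z_{k+1} - z_k); see ∂-spec.  The product
  -- clause is S k (fg) - fg = (S k f - f) g + S k f (S k g - g).
  ∂ : ∀ {N} → Fin N → Polyz N → Polyz N
  ∂ k (con a) = con K.0#
  ∂ k (var j) = if does (j Fin.≟ k) then con K.1#
                else if does (j Fin.≟ next k) then ⊖ con K.1#
                else con K.0#
  ∂ k (f ⊕ g) = ∂ k f ⊕ ∂ k g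
  ∂ k (f ⊗ g) = ∂ k f ⊗ g ⊕ S k f ⊗ ∂ k g
  ∂ k (⊖ f)   = ⊖ ∂ k f

  D : ∀ {N} → Fin N → Polyz N → Polyz N
  D k f = (con q ⊗ z k ⊝ con q⁻¹ ⊗ z (next k)) ⊗ ∂ k f

  module _ {N : ℕ} (k : Fin N) where

    private
      module P = CommutativeRing (poly-ring (Fin N))
      module PS = CommutativeSemiringSolver P.commutativeSemiring
      open PS using (solve; _:=_; _:+_; _:*_)
      open RingProperties P.ring
        using (-‿distribʳ-*; -‿+-comm)
      open GroupProperties P.+-group using (⁻¹-involutive)
      open SetoidReasoning P.setoid

      Δ : Polyz N
      Δ = z (next k) ⊝ z k

      Δ⊕z : ∀ f g → f ≋ g ⊕ (f ⊝ g)
      Δ⊕z f g = begin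
        f               ≈⟨ P.+-identityʳ f ⟨
        f ⊕ con K.0#    ≈⟨ P.+-congˡ (P.-‿inverseˡ g) ⟨
        f ⊕ (⊖ g ⊕ g)   ≈⟨ P.+-assoc f (⊖ g) g ⟨
        (f ⊝ g) ⊕ g     ≈⟨ P.+-comm (f ⊝ g) g ⟩
        g ⊕ (f ⊝ g)     ∎

      stays : ∀ f → f ≋ f ⊕ Δ ⊗ con K.0#
      stays f = ≋-sym (≋-trans (P.+-congˡ (P.zeroʳ Δ)) (P.+-identityʳ f))

      ⊖Δ : ⊖ Δ ≋ z k ⊝ z (next k)
      ⊖Δ = begin
        ⊖ (z (next k) ⊕ ⊖ z k)      ≈⟨ -‿+-comm (z (next k)) (⊖ z k) ⟨
        ⊖ z (next k) ⊕ ⊖ (⊖ z k)    ≈⟨ P.+-congˡ (⁻¹-involutive (z k)) ⟩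
        ⊖ z (next k) ⊕ z k          ≈⟨ P.+-comm _ _ ⟩
        z k ⊝ z (next k)            ∎

      expand-var : ∀ j → S k (var j) ≋ var j ⊕ Δ ⊗ ∂ k (var j)
      expand-var j with j Fin.≟ k
      ... | yes ≡.refl = begin
            z (next k)                   ≈⟨ Δ⊕z (z (next k)) (z k) ⟩
            z k ⊕ Δ                      ≈⟨ P.+-congˡ (P.*-identityʳ Δ) ⟨
            z k ⊕ Δ ⊗ con K.1#           ∎
      ... | no _ with j Fin.≟ next k
      ...   | yes ≡.refl = begin
              z k                            ≈⟨ Δ⊕z (z k) (z (next k)) ⟩
              z (next k) ⊕ (z k ⊝ z (next k)) ≈⟨ P.+-congˡ ⊖Δ ⟨
              z (next k) ⊕ ⊖ Δ
                ≈⟨ P.+-congˡ (P.-‿cong (P.*-identityʳ Δ)) ⟨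
              z (next k) ⊕ ⊖ (Δ ⊗ con K.1#)
                ≈⟨ P.+-congˡ (-‿distribʳ-* Δ (con K.1#)) ⟩
              z (next k) ⊕ Δ ⊗ ⊖ con K.1#    ∎
      ...   | no _ = stays (var j)

      expand : ∀ f → S k f ≋ f ⊕ Δ ⊗ ∂ k f
      expand (con a) = stays (con a)
      expand (var j) = expand-var j
      expand (f ⊕ g) = ≋-trans (⊕-cong (expand f) (expand g))
        (solve 5 (λ f g d x y → (f :+ d :* x) :+ (g :+ d :* y)
                             := (f :+ g) :+ d :* (x :+ y))
          ≋-refl f g Δ (∂ k f) (∂ k g))
      expand (f ⊗ g) = begin
        S k f ⊗ S k g                      ≈⟨ P.*-congˡ (expand g) ⟩
        S k f ⊗ (g ⊕ Δ ⊗ ∂ k g)            ≈⟨ P.distribˡ _ _ _ ⟩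
        S k f ⊗ g ⊕ S k f ⊗ (Δ ⊗ ∂ k g)    ≈⟨ P.+-congʳ (P.*-congʳ (expand f)) ⟩
        (f ⊕ Δ ⊗ ∂ k f) ⊗ g ⊕ S k f ⊗ (Δ ⊗ ∂ k g)
          ≈⟨ solve 6 (λ f g d x y s → (f :+ d :* x) :* g :+ s :* (d :* y)
                                   := f :* g :+ d :* (x :* g :+ s :* y))
               ≋-refl f g Δ (∂ k f) (∂ k g) (S k f) ⟩
        f ⊗ g ⊕ Δ ⊗ (∂ k f ⊗ g ⊕ S k f ⊗ ∂ k g) ∎
      expand (⊖ f) = begin
        ⊖ S k f                ≈⟨ P.-‿cong (expand f) ⟩
        ⊖ (f ⊕ Δ ⊗ ∂ k f)      ≈⟨ -‿+-comm f (Δ ⊗ ∂ k f) ⟨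
        ⊖ f ⊕ ⊖ (Δ ⊗ ∂ k f)    ≈⟨ P.+-congˡ (-‿distribʳ-* Δ (∂ k f)) ⟩
        ⊖ f ⊕ Δ ⊗ ⊖ ∂ k f      ∎

    ∂-spec : ∀ f → (z (next k) ⊝ z k) ⊗ ∂ k f ≋ S k f ⊝ f
    ∂-spec f = ≋-sym (begin
      S k f ⊝ f                  ≈⟨ P.+-congʳ (expand f) ⟩
      (f ⊕ Δ ⊗ ∂ k f) ⊝ f        ≈⟨ P.+-congʳ (P.+-comm f (Δ ⊗ ∂ k f)) ⟩
      (Δ ⊗ ∂ k f ⊕ f) ⊝ f        ≈⟨ P.+-assoc _ f (⊖ f) ⟩
      Δ ⊗ ∂ k f ⊕ (f ⊝ f)        ≈⟨ P.+-congˡ (P.-‿inverseʳ f) ⟩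
      Δ ⊗ ∂ k f ⊕ con K.0#       ≈⟨ P.+-identityʳ _ ⟩
      Δ ⊗ ∂ k f                  ∎)

    D-spec : ∀ f → (z (next k) ⊝ z k) ⊗ D k f
                 ≋ (con q ⊗ z k ⊝ con q⁻¹ ⊗ z (next k)) ⊗ (S k f ⊝ f)
    D-spec f = ≋-trans
      (solve 3 (λ d c x → d :* (c :* x) := c :* (d :* x)) ≋-refl
        Δ (con q ⊗ z k ⊝ con q⁻¹ ⊗ z (next k)) (∂ k f))
      (P.*-congˡ (∂-spec f))

    S-cong : ∀ {f g} → f ≋ g → S k f ≋ S k g
    S-cong = rename-cong (transpose k (next k))

    ∂-cong : ∀ {f g} → f ≋ g → ∂ k f ≋ ∂ k g
    ∂-cong ≋-refl          = ≋-refl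
    ∂-cong (≋-sym e)       = ≋-sym (∂-cong e)
    ∂-cong (≋-trans e e′)  = ≋-trans (∂-cong e) (∂-cong e′)
    ∂-cong (⊕-cong e e′)   = ⊕-cong (∂-cong e) (∂-cong e′)
    ∂-cong (⊗-cong e e′)   =
      ⊕-cong (⊗-cong (∂-cong e) e′) (⊗-cong (S-cong e) (∂-cong e′))
    ∂-cong (⊖-cong e)      = ⊖-cong (∂-cong e)
    ∂-cong (con-cong e)    = ≋-refl
    ∂-cong (con-+ a b)     = ≋-sym (⊕-identityˡ (con K.0#))
    ∂-cong (con-* a b)     = solve 2 (λ a b →
      PS.con 0 := PS.con 0 :* b :+ a :* PS.con 0) ≋-refl (con a) (con b)
    ∂-cong (⊕-assoc f g h) = ⊕-assoc _ _ _
    ∂-cong (⊕-comm f g)    = ⊕-comm _ _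
    ∂-cong (⊕-identityˡ f) = ⊕-identityˡ _
    ∂-cong (⊖-inverseˡ f)  = ⊖-inverseˡ _
    ∂-cong (⊗-assoc f g h) =
      solve 7 (λ x y w g h s t →
        (x :* g :+ s :* y) :* h :+ (s :* t) :* w
        := x :* (g :* h) :+ s :* (y :* h :+ t :* w))
        ≋-refl (∂ k f) (∂ k g) (∂ k h) g h (S k f) (S k g)
    ∂-cong (⊗-comm f g)    = begin
      ∂ k f ⊗ g ⊕ S k f ⊗ ∂ k g             ≈⟨ P.+-congˡ (P.*-congʳ (expand f)) ⟩
      ∂ k f ⊗ g ⊕ (f ⊕ Δ ⊗ ∂ k f) ⊗ ∂ k g
        ≈⟨ solve 5 (λ f g d x y → x :* g :+ (f :+ d :* x) :* y
                               := y :* f :+ (g :+ d :* y) :* x)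
             ≋-refl f g Δ (∂ k f) (∂ k g) ⟩
      ∂ k g ⊗ f ⊕ (g ⊕ Δ ⊗ ∂ k g) ⊗ ∂ k f   ≈⟨ P.+-congˡ (P.*-congʳ (expand g)) ⟨
      ∂ k g ⊗ f ⊕ S k g ⊗ ∂ k f             ∎
    ∂-cong (⊗-identityˡ f) = solve 2 (λ f x →
      PS.con 0 :* f :+ PS.con 1 :* x := x) ≋-refl f (∂ k f)
    ∂-cong (⊗-distribˡ f g h) =
      solve 6 (λ x y w g h s →
        x :* (g :+ h) :+ s :* (y :+ w) := (x :* g :+ s :* y) :+ (x :* h :+ s :* w))
        ≋-refl (∂ k f) (∂ k g) (∂ k h) g h (S k f)

    D-cong : ∀ {f g} → f ≋ g → D k f ≋ D k g
    D-cong e = P.*-congˡ (∂-cong e)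

  module _ {N : ℕ} where

    f : Fin N → Fin N → Polyz N
    f i j = con 1/[q-q⁻¹] ⊗ (con q ⊗ z i ⊝ con q⁻¹ ⊗ z j)

    g h : Fin N → Polyz N
    g i = con 1/[q-q⁻¹] ⊗ (con q ⊝ con q⁻¹ ⊗ z i)
    h i = con 1/[q-q⁻¹] ⊗ (con q ⊗ z i ⊝ con q⁻¹)

    f-power : (OffDiagonal N → ℕ) → Fin N → Fin N → Polyz N
    f-power α i j with i Fin.≟ j
    ... | yes _  = con K.1#
    ... | no i≢j = f i j ^ α (pair i j i≢j)

    P : (OffDiagonal N → ℕ) → (Fin N → ℕ) → (Fin N → ℕ) → Polyz N
    P α β γ = ∏ (λ i → ∏ (f-power α i)) ⊗ ∏ (λ i → g i ^ β i ⊗ h i ^ γ i)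

  parameters : ∀ {N} → (OffDiagonal N → ℕ) → (Fin N → ℕ) → (Fin N → ℕ) →
               Parameter N → K.Carrier
  parameters α β γ = fromℕ ∘ [ α , [ β , γ ]′ ]′

------------------------------------------------------------------------
-- The field ℚ(q)

ℚ-integral : ∀ a b → a ℚ.* b ≡ 0ℚ → a ≡ 0ℚ ⊎ b ≡ 0ℚ
ℚ-integral a b ab≡0 with a ℚ.≟ 0ℚ
... | yes a≡0 = inj₁ a≡0
... | no  a≢0 = inj₂ (begin
  b                      ≡⟨ ℚ.*-identityˡ b ⟨
  1ℚ ℚ.* b               ≡⟨ ≡.cong (ℚ._* b) (ℚ.*-inverseˡ a) ⟨
  (ℚ.1/ a ℚ.* a) ℚ.* b   ≡⟨ ℚ.*-assoc (ℚ.1/ a) a b ⟩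
  ℚ.1/ a ℚ.* (a ℚ.* b)   ≡⟨ ≡.cong (ℚ.1/ a ℚ.*_) ab≡0 ⟩
  ℚ.1/ a ℚ.* 0ℚ          ≡⟨ ℚ.*-zeroʳ (ℚ.1/ a) ⟩
  0ℚ                     ∎)
  where
  open ≡.≡-Reasoning
  instance
    a-nonZero : ℚ.NonZero a
    a-nonZero = ℚ.≢-nonZero a≢0

module ℚ[q] = Univariate ℚ.+-*-commutativeRing

private
  1≉0 : ¬ ((1ℚ ∷ []) ℚ[q].≋ [])
  1≉0 e with ℚ[q].at e 0
  ... | ()

module ℚ⟨q⟩ = FractionField ℚ[q].commutativeRing 1≉0
                (ℚ[q].integral (ℚ._≟ 0ℚ) ℚ-integral)

ℚ⟨q⟩-ring : CommutativeRing 0ℓ 0ℓ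
ℚ⟨q⟩-ring = ℚ⟨q⟩.commutativeRing

private module F = CommutativeRing ℚ⟨q⟩-ring

q : F.Carrier
q = ℚ⟨q⟩.ι (0ℚ ∷ 1ℚ ∷ [])

q≉0 : ¬ (q F.≈ F.0#)
q≉0 (ℚ⟨q⟩.cross e) with ℚ[q].at e 1
... | ()

q⁻¹ : F.Carrier
q⁻¹ = ℚ⟨q⟩.recip q q≉0

q-q⁻¹≉0 : ¬ ((q F.- q⁻¹) F.≈ F.0#)
q-q⁻¹≉0 (ℚ⟨q⟩.cross e) with ℚ[q].at e 0
... | ()

1/[q-q⁻¹] : F.Carrier
1/[q-q⁻¹] = ℚ⟨q⟩.recip (q F.- q⁻¹) q-q⁻¹≉0

open Multivariate ℚ⟨q⟩-ring public using (Poly; eval; TotalDegree≤)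
open Operators ℚ⟨q⟩-ring q q⁻¹ 1/[q-q⁻¹] public

module Submission where

-- D_k is ∂_k followed by multiplication by a fixed polynomial.  So it suffices
-- to control, for families F of polynomials in z indexed by the parameters, the
-- values at z = 1 of all words of length r in the operators ∂: call F tame if
-- these are polynomials of degree at most r in the parameters.  Tameness passes
-- to products by the twisted Leibniz rule, because S_k F = F + (z_{k+1} - z_k) ∂_k F
-- is tame whenever F is.  It remains to treat a power u^n with u = 1 at z = 1.
-- Put x = u - 1; the binomial expansion u^n = Σ_s C(n,s) x^s has a number of
-- terms that depends on n, but its s-th term involves a coefficient of degree s
-- in n and a factor x^s that vanishes to order s, so only finitely many terms
-- are seen by a word of given length.

open import Level using (0ℓ)
open import Algebra.Bundles using (CommutativeRing)
open import Data.Fin.Base using (Fin; zero; suc)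
import Data.Fin.Properties as Fin
open import Data.List.Base using (List; []; _∷_; _++_; map; length)
open import Data.List.Properties using (length-++)
open import Data.List.Relation.Unary.All as All using (All; []; _∷_)
import Data.List.Relation.Unary.All.Properties as All
open import Data.Nat.Base as ℕ using (ℕ; zero; suc; _*_; _≤_; z≤n; s≤s)
open import Data.Nat.Combinatorics using (_C_; nCk+nC[k+1]≡[n+1]C[k+1]; k>n⇒nCk≡0)
import Data.Nat.Properties as ℕ
import Data.Nat.Solver as ℕ
open import Data.Product.Base using (Σ-syntax; _×_; _,_; proj₁; proj₂)
open import Data.Rational.Base as ℚ using (ℚ; 1ℚ)
import Data.Rational.Properties as ℚ
open import Data.Sum.Base using (inj₁; inj₂)
open import Data.Vec.Base using (Vec; []; _∷_; foldr′)
open import Function.Base using (_∘_)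
open import Relation.Binary.PropositionalEquality as ≡ using (_≡_)
open import Relation.Nullary using (yes; no)

import Algebra.Definitions.RawMonoid as RawMonoid
import Algebra.Properties.CommutativeMonoid.Sum as CommutativeMonoidSum
import Algebra.Properties.Ring as RingProperties
import Algebra.Properties.Semiring.Exp as Exp
import Algebra.Properties.Semiring.Mult as Mult
import Algebra.Solver.Ring.NaturalCoefficients.Default as CommutativeSemiringSolver
import Relation.Binary.Reasoning.Setoid as SetoidReasoning

open import Defs using (module Multivariate; module Operators; next;
  OffDiagonal; pair; Parameter)

-- Absorption identity for binomial coefficients.

0C[1+k]≡0 : ∀ k → 0 C suc k ≡ 0
0C[1+k]≡0 k = k>n⇒nCk≡0 {0} {suc k} ℕ.z<s

-- This is (k+1) C(n,k+1) = (n-k) C(n,k) with the subtraction moved across, so that it also makes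
-- sense in ℕ for k > n. Pascal's rule reduces n+1 to two instances at n.
[1+k]*nC[1+k]+k*nCk≡n*nCk : ∀ n k →
  suc k * (n C suc k) ℕ.+ k * (n C k) ≡ n * (n C k)
[1+k]*nC[1+k]+k*nCk≡n*nCk zero zero = ≡.refl
[1+k]*nC[1+k]+k*nCk≡n*nCk zero (suc k)
  rewrite 0C[1+k]≡0 k | 0C[1+k]≡0 (suc k) | ℕ.*-zeroʳ k = ≡.refl
[1+k]*nC[1+k]+k*nCk≡n*nCk (suc n) zero = begin
  1 * (suc n C 1) ℕ.+ 0    ≡⟨ ≡.cong (λ c → 1 * c ℕ.+ 0) (nCk+nC[k+1]≡[n+1]C[k+1] n 0) ⟨
  1 * (1 ℕ.+ n C 1) ℕ.+ 0  ≡⟨ ≡.cong suc ([1+k]*nC[1+k]+k*nCk≡n*nCk n 0) ⟩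
  suc n * 1                ∎
  where open ≡.≡-Reasoning
[1+k]*nC[1+k]+k*nCk≡n*nCk (suc n) (suc k) = begin
  suc (suc k) * (suc n C suc (suc k)) ℕ.+ suc k * (suc n C suc k)
    ≡⟨ ≡.cong₂ (λ a b → suc (suc k) * a ℕ.+ suc k * b)
         (nCk+nC[k+1]≡[n+1]C[k+1] n (suc k)) (nCk+nC[k+1]≡[n+1]C[k+1] n k) ⟨
  suc (suc k) * (n C suc k ℕ.+ n C suc (suc k)) ℕ.+ suc k * (n C k ℕ.+ n C suc k)
    ≡⟨ solve 4 (λ k a b c →
         (con 2 :+ k) :* (b :+ c) :+ (con 1 :+ k) :* (a :+ b)
         := (b :+ ((con 2 :+ k) :* c :+ (con 1 :+ k) :* b))
            :+ (a :+ ((con 1 :+ k) :* b :+ k :* a)))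
         ≡.refl k (n C k) (n C suc k) (n C suc (suc k)) ⟩
  (n C suc k ℕ.+ (suc (suc k) * (n C suc (suc k)) ℕ.+ suc k * (n C suc k)))
    ℕ.+ (n C k ℕ.+ (suc k * (n C suc k) ℕ.+ k * (n C k)))
    ≡⟨ ≡.cong₂ (λ a b → (n C suc k ℕ.+ a) ℕ.+ (n C k ℕ.+ b))
         ([1+k]*nC[1+k]+k*nCk≡n*nCk n (suc k)) ([1+k]*nC[1+k]+k*nCk≡n*nCk n k) ⟩
  suc n * (n C suc k) ℕ.+ suc n * (n C k)
    ≡⟨ solve 3 (λ n a b → (con 1 :+ n) :* b :+ (con 1 :+ n) :* a
         := (con 1 :+ n) :* (a :+ b)) ≡.refl n (n C k) (n C suc k) ⟩
  suc n * (n C k ℕ.+ n C suc k)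
    ≡⟨ ≡.cong (suc n *_) (nCk+nC[k+1]≡[n+1]C[k+1] n k) ⟩
  suc n * (suc n C suc k) ∎
  where
  open ≡.≡-Reasoning
  open ℕ.+-*-Solver

-- Total degree and polynomial functions of the parameters.

module PolynomialFunctions (K : CommutativeRing 0ℓ 0ℓ) where

  private module K = CommutativeRing K
  open Multivariate K

  module _ {X : Set} where

    private
      module P = CommutativeRing (poly-ring X)
      module PS = CommutativeSemiringSolver P.commutativeSemiring
      open PS using (solve; _:=_; _:+_; _:*_)

    Terms : Set
    Terms = List (K.Carrier × List X)

    monomial-++ : ∀ xs ys → monomial (xs ++ ys) ≋ monomial xs ⊗ monomial ys
    monomial-++ []       ys = ≋-sym (⊗-identityˡ _)
    monomial-++ (x ∷ xs) ys =
      ≋-trans (P.*-congˡ (monomial-++ xs ys)) (≋-sym (⊗-assoc _ _ _))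

    combination-++ : ∀ (ts us : Terms) →
      combination (ts ++ us) ≋ combination ts ⊕ combination us
    combination-++ []       us = ≋-sym (⊕-identityˡ _)
    combination-++ (t ∷ ts) us =
      ≋-trans (P.+-congˡ (combination-++ ts us)) (≋-sym (⊕-assoc _ _ _))

    scale : K.Carrier × List X → Terms → Terms
    scale (a , xs) = map λ (b , ys) → a K.* b , xs ++ ys

    combination-scale : ∀ a xs (us : Terms) →
      combination (scale (a , xs) us) ≋ (con a ⊗ monomial xs) ⊗ combination us
    combination-scale a xs []              = ≋-sym (P.zeroʳ _)
    combination-scale a xs ((b , ys) ∷ us) = ≋-trans
      (⊕-cong (⊗-cong (con-* a b) (monomial-++ xs ys)) (combination-scale a xs us))
      (solve 5 (λ a x b y u → (a :* b) :* (x :* y) :+ (a :* x) :* u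
                           := (a :* x) :* (b :* y :+ u))
        ≋-refl (con a) (monomial xs) (con b) (monomial ys) (combination us))

    multiply : Terms → Terms → Terms
    multiply []       us = []
    multiply (t ∷ ts) us = scale t us ++ multiply ts us

    combination-multiply : ∀ (ts us : Terms) →
      combination (multiply ts us) ≋ combination ts ⊗ combination us
    combination-multiply []              us = ≋-sym (P.zeroˡ _)
    combination-multiply ((a , xs) ∷ ts) us = ≋-trans
      (combination-++ (scale (a , xs) us) (multiply ts us))
      (≋-trans (⊕-cong (combination-scale a xs us) (combination-multiply ts us))
        (≋-sym (P.distribʳ _ _ _)))

    multiply-degree : ∀ {d e} {ts us : Terms} →
      All (λ t → length (proj₂ t) ≤ d) ts → All (λ t → length (proj₂ t) ≤ e) us →
      All (λ t → length (proj₂ t) ≤ d ℕ.+ e) (multiply ts us)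
    multiply-degree []                           us≤e = []
    multiply-degree {ts = (_ , xs) ∷ _} (t≤d ∷ ts≤d) us≤e = All.++⁺
      (All.map⁺ (All.map (λ u≤e → ≡.subst (_≤ _) (≡.sym (length-++ xs))
        (ℕ.+-mono-≤ t≤d u≤e)) us≤e))
      (multiply-degree ts≤d us≤e)

    TotalDegree≤-⊕ : ∀ {d} {f g : Poly X} →
      TotalDegree≤ d f → TotalDegree≤ d g → TotalDegree≤ d (f ⊕ g)
    TotalDegree≤-⊕ (ts , ts≤d , f≋) (us , us≤d , g≋) = ts ++ us , All.++⁺ ts≤d us≤d ,
      ≋-trans (⊕-cong f≋ g≋) (≋-sym (combination-++ ts us))

    TotalDegree≤-⊗ : ∀ {d e} {f g : Poly X} →
      TotalDegree≤ d f → TotalDegree≤ e g → TotalDegree≤ (d ℕ.+ e) (f ⊗ g)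
    TotalDegree≤-⊗ (ts , ts≤d , f≋) (us , us≤e , g≋) =
      multiply ts us , multiply-degree ts≤d us≤e ,
      ≋-trans (⊗-cong f≋ g≋) (≋-sym (combination-multiply ts us))

    TotalDegree≤-con : ∀ a → TotalDegree≤ {X} 0 (con a)
    TotalDegree≤-con a = (a , []) ∷ [] , z≤n ∷ [] ,
      ≋-sym (≋-trans (P.+-identityʳ _) (P.*-identityʳ _))

    TotalDegree≤-var : ∀ x → TotalDegree≤ {X} 1 (var x)
    TotalDegree≤-var x = (K.1# , x ∷ []) ∷ [] , s≤s z≤n ∷ [] ,
      ≋-sym (≋-trans (P.+-identityʳ _) (≋-trans (⊗-identityˡ _) (P.*-identityʳ _)))

    TotalDegree≤-mono : ∀ {d e} {f : Poly X} → d ≤ e → TotalDegree≤ d f → TotalDegree≤ e f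
    TotalDegree≤-mono d≤e (ts , ts≤d , f≋) =
      ts , All.map (λ t≤d → ℕ.≤-trans t≤d d≤e) ts≤d , f≋

  module _ {A X : Set} (ρ : A → X → K.Carrier) where

    -- The polynomial is chosen once for all `a`, which enters only through the values `ρ a` of the
    -- variables.
    record Polynomial≤ (d : ℕ) (c : A → K.Carrier) : Set where
      constructor polynomial
      field
        poly   : Poly X
        degree : TotalDegree≤ d poly
        agrees : ∀ a → c a K.≈ eval (ρ a) poly

  module _ {A X : Set} {ρ : A → X → K.Carrier} where

    Polynomial≤-cong : ∀ {d b c} → (∀ a → c a K.≈ b a) →
      Polynomial≤ ρ d b → Polynomial≤ ρ d c
    Polynomial≤-cong c≈b (polynomial Q deg eq) =
      polynomial Q deg λ a → K.trans (c≈b a) (eq a)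

    Polynomial≤-mono : ∀ {d e c} → d ≤ e → Polynomial≤ ρ d c → Polynomial≤ ρ e c
    Polynomial≤-mono d≤e (polynomial Q deg eq) =
      polynomial Q (TotalDegree≤-mono d≤e deg) eq

    Polynomial≤-const : ∀ {d} k → Polynomial≤ ρ d (λ _ → k)
    Polynomial≤-const k =
      polynomial (con k) (TotalDegree≤-mono z≤n (TotalDegree≤-con k)) λ _ → K.refl

    Polynomial≤-var : ∀ x → Polynomial≤ ρ 1 (λ a → ρ a x)
    Polynomial≤-var x = polynomial (var x) (TotalDegree≤-var x) λ _ → K.refl

    Polynomial≤-+ : ∀ {d b c} → Polynomial≤ ρ d b → Polynomial≤ ρ d c →
      Polynomial≤ ρ d (λ a → b a K.+ c a)
    Polynomial≤-+ (polynomial Q deg eq) (polynomial Q′ deg′ eq′) =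
      polynomial (Q ⊕ Q′) (TotalDegree≤-⊕ deg deg′) λ a → K.+-cong (eq a) (eq′ a)

    Polynomial≤-* : ∀ {d e b c} → Polynomial≤ ρ d b → Polynomial≤ ρ e c →
      Polynomial≤ ρ (d ℕ.+ e) (λ a → b a K.* c a)
    Polynomial≤-* (polynomial Q deg eq) (polynomial Q′ deg′ eq′) =
      polynomial (Q ⊗ Q′) (TotalDegree≤-⊗ deg deg′) λ a → K.*-cong (eq a) (eq′ a)

module TameFamilies
  (K : CommutativeRing 0ℓ 0ℓ)
  (q q⁻¹ 1/[q-q⁻¹] : CommutativeRing.Carrier K)
  where

  private module K = CommutativeRing K
  open Multivariate K
  open Operators K q q⁻¹ 1/[q-q⁻¹]
  open PolynomialFunctions K

  -- Evaluation at z = 1 and the exchange of variables.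

  at1 : ∀ {N} → Polyz N → K.Carrier
  at1 = eval λ _ → K.1#

  -- The point (1,...,1) is fixed by all permutations of the coordinates.
  at1-S : ∀ {N} (k : Fin N) F → at1 (S k F) ≡ at1 F
  at1-S k (con a) = ≡.refl
  at1-S k (var j) = ≡.refl
  at1-S k (F ⊕ G) = ≡.cong₂ K._+_ (at1-S k F) (at1-S k G)
  at1-S k (F ⊗ G) = ≡.cong₂ K._*_ (at1-S k F) (at1-S k G)
  at1-S k (⊖ F)   = ≡.cong K.-_ (at1-S k F)

  module _ {N : ℕ} (k : Fin N) where

    private
      module P = CommutativeRing (poly-ring (Fin N))
      open SetoidReasoning P.setoid

    S≋id+Δ∂ : ∀ F → S k F ≋ F ⊕ (z (next k) P.- z k) ⊗ ∂ k F
    S≋id+Δ∂ F = begin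
      S k F                                ≈⟨ P.+-identityʳ _ ⟨
      S k F ⊕ con K.0#                     ≈⟨ P.+-congˡ (⊖-inverseˡ F) ⟨
      S k F ⊕ (⊖ F ⊕ F)                    ≈⟨ ⊕-assoc _ _ _ ⟨
      (S k F ⊕ ⊖ F) ⊕ F                    ≈⟨ ⊕-comm _ _ ⟩
      F ⊕ (S k F ⊕ ⊖ F)                    ≈⟨ P.+-congˡ (∂-spec k F) ⟨
      F ⊕ (z (next k) P.- z k) ⊗ ∂ k F     ∎

  -- Binomial expansion of powers.

  fromℕ-+ : ∀ m n → fromℕ (m ℕ.+ n) K.≈ fromℕ m K.+ fromℕ n
  fromℕ-+ = Mult.×-homo-+ K.semiring K.1#

  fromℕ-* : ∀ m n → fromℕ (m * n) K.≈ fromℕ m K.* fromℕ n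
  fromℕ-* = Mult.×1-homo-* K.semiring

  module _ {N : ℕ} (u : Polyz N) where

    private
      module P = CommutativeRing (poly-ring (Fin N))
      module PS = CommutativeSemiringSolver P.commutativeSemiring
      open PS using (solve; _:=_; _:+_; _:*_)
      open Exp P.semiring using (_^_)
      open SetoidReasoning P.setoid

      x : Polyz N
      x = u P.- P.1#

      1+x≋u : P.1# ⊕ x ≋ u
      1+x≋u = ≋-trans (P.+-congˡ (⊕-comm _ _)) (≋-trans (≋-sym (⊕-assoc _ _ _))
        (≋-trans (P.+-congʳ (P.-‿inverseʳ _)) (⊕-identityˡ _)))

    -- tail t n = Σ_{s ≥ t} C(n,s) (u - 1)^(s-t), by Pascal's rule.
    tail : ℕ → ℕ → Polyz N
    tail zero    n       = u ^ n
    tail (suc t) zero    = con K.0#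
    tail (suc t) (suc n) = tail t n ⊕ tail (suc t) n

    -- Splits off the term s = t, which leaves a factor u - 1 in front of the rest. The expansion of
    -- `u ^ n` can thus be unrolled as far as needed, however large n is.
    tail-expand : ∀ t n →
      tail t n ≋ con (fromℕ (n C t)) ⊕ (u P.- P.1#) ⊗ tail (suc t) n
    tail-expand zero zero = ≋-sym (begin
      con (fromℕ 1) ⊕ x ⊗ con K.0#  ≈⟨ P.+-congˡ (P.zeroʳ x) ⟩
      con (fromℕ 1) ⊕ con K.0#      ≈⟨ P.+-identityʳ _ ⟩
      con (fromℕ 1)                 ≈⟨ con-cong (K.+-identityʳ _) ⟩
      con K.1#                      ∎)
    tail-expand zero (suc n) = begin
      u ⊗ u ^ n                                     ≈⟨ P.*-congʳ 1+x≋u ⟨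
      (P.1# ⊕ x) ⊗ u ^ n                            ≈⟨ P.distribʳ _ _ _ ⟩
      P.1# ⊗ u ^ n ⊕ x ⊗ u ^ n                      ≈⟨ P.+-congʳ (⊗-identityˡ _) ⟩
      u ^ n ⊕ x ⊗ u ^ n                             ≈⟨ P.+-congʳ (tail-expand zero n) ⟩
      (con (fromℕ 1) ⊕ x ⊗ tail 1 n) ⊕ x ⊗ u ^ n
        ≈⟨ solve 4 (λ c x r p → (c :+ x :* r) :+ x :* p := c :+ x :* (p :+ r))
             ≋-refl (con (fromℕ 1)) x (tail 1 n) (u ^ n) ⟩
      con (fromℕ 1) ⊕ x ⊗ (u ^ n ⊕ tail 1 n)        ∎
    tail-expand (suc t) zero rewrite 0C[1+k]≡0 t = ≋-sym (begin
      con K.0# ⊕ x ⊗ con K.0#  ≈⟨ ⊕-identityˡ _ ⟩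
      x ⊗ con K.0#             ≈⟨ P.zeroʳ x ⟩
      con K.0#                 ∎)
    tail-expand (suc t) (suc n) = begin
      tail t n ⊕ tail (suc t) n
        ≈⟨ ⊕-cong (tail-expand t n) (tail-expand (suc t) n) ⟩
      (con (fromℕ (n C t)) ⊕ x ⊗ tail (suc t) n)
        ⊕ (con (fromℕ (n C suc t)) ⊕ x ⊗ tail (suc (suc t)) n)
        ≈⟨ solve 5 (λ a b x r s → (a :+ x :* r) :+ (b :+ x :* s)
                               := (a :+ b) :+ x :* (r :+ s))
             ≋-refl (con (fromℕ (n C t))) (con (fromℕ (n C suc t))) x
             (tail (suc t) n) (tail (suc (suc t)) n) ⟩
      -- The sum of the two tails is the defining clause of `tail (suc (suc t)) (suc n)`.
      (con (fromℕ (n C t)) ⊕ con (fromℕ (n C suc t))) ⊕ x ⊗ tail (suc (suc t)) (suc n)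
        ≈⟨ P.+-congʳ (≋-trans (≋-sym (con-+ _ _))
             (con-cong (K.sym (fromℕ-+ (n C t) (n C suc t))))) ⟩
      con (fromℕ (n C t ℕ.+ n C suc t)) ⊕ x ⊗ tail (suc (suc t)) (suc n)
        ≡⟨ ≡.cong (λ c → con (fromℕ c) ⊕ x ⊗ tail (suc (suc t)) (suc n))
             (nCk+nC[k+1]≡[n+1]C[k+1] n t) ⟩
      con (fromℕ (suc n C suc t)) ⊕ x ⊗ tail (suc (suc t)) (suc n) ∎

  -- Tame families and their closure properties.

  module _ {A X : Set} (ρ : A → X → K.Carrier) {N : ℕ} where

    -- Tame m d F: for every r ≤ m, applying r of the operators ∂ to F and then
    -- evaluating at 1 gives a polynomial of degree at most d + r in the
    -- parameters ρ.
    data Tame : ℕ → ℕ → (A → Polyz N) → Set where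
      value : ∀ {d F} → Polynomial≤ ρ d (at1 ∘ F) → Tame 0 d F
      step  : ∀ {m d F} → Polynomial≤ ρ d (at1 ∘ F) →
              (∀ k → Tame m (suc d) (∂ k ∘ F)) → Tame (suc m) d F

  module _ {A X : Set} {ρ : A → X → K.Carrier} {N : ℕ} where

    private
      module P = CommutativeRing (poly-ring (Fin N))
      variable
        m d e : ℕ
        F G   : A → Polyz N
        c     : Polyz N

    Tame-at1 : Tame ρ m d F → Polynomial≤ ρ d (at1 ∘ F)
    Tame-at1 (value v)  = v
    Tame-at1 (step v _) = v

    Tame-cong : (∀ a → G a ≋ F a) → Tame ρ m d F → Tame ρ m d G
    Tame-cong G≋F (value v)  = value (Polynomial≤-cong (eval-cong _ ∘ G≋F) v)
    Tame-cong G≋F (step v s) = step (Polynomial≤-cong (eval-cong _ ∘ G≋F) v)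
      λ k → Tame-cong (∂-cong k ∘ G≋F) (s k)

    Tame-pred : Tame ρ (suc m) d F → Tame ρ m d F
    Tame-pred {m = zero}  (step v _) = value v
    Tame-pred {m = suc _} (step v s) = step v λ k → Tame-pred (s k)

    Tame-mono : d ≤ e → Tame ρ m d F → Tame ρ m e F
    Tame-mono d≤e (value v)  = value (Polynomial≤-mono d≤e v)
    Tame-mono d≤e (step v s) =
      step (Polynomial≤-mono d≤e v) λ k → Tame-mono (s≤s d≤e) (s k)

    Tame-const : ∀ (c : Polyz N) → Tame ρ m d (λ _ → c)
    Tame-const {m = zero}  c = value (Polynomial≤-const _)
    Tame-const {m = suc _} c = step (Polynomial≤-const _) λ k → Tame-const (∂ k c)

    Tame-scalar : ∀ {b : A → K.Carrier} →
      Polynomial≤ ρ d b → Tame ρ m d (con {Fin N} ∘ b)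
    Tame-scalar {m = zero}  b≤d = value b≤d
    Tame-scalar {m = suc _} b≤d = step b≤d λ _ → Tame-const (con K.0#)

    Tame-⊕ : Tame ρ m d F → Tame ρ m d G → Tame ρ m d (λ a → F a ⊕ G a)
    Tame-⊕ (value v)  (value w)  = value (Polynomial≤-+ v w)
    Tame-⊕ (step v s) (step w t) =
      step (Polynomial≤-+ v w) λ k → Tame-⊕ (s k) (t k)

    -- A factor free of the parameters does not raise the degree. It has to be arbitrary, because
    -- the Leibniz rule replaces `c` by `∂ k c` and `S k c`.
    Tame-scale : ∀ (c : Polyz N) → Tame ρ m d F → Tame ρ m d (λ a → c ⊗ F a)
    Tame-scale c (value v)      = value (Polynomial≤-* (Polynomial≤-const _) v)
    Tame-scale c Ft@(step v s) = step (Polynomial≤-* (Polynomial≤-const _) v)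
      λ k → Tame-⊕ (Tame-scale (∂ k c) (Tame-mono (ℕ.n≤1+n _) (Tame-pred Ft)))
                   (Tame-scale (S k c) (s k))

    -- A factor that vanishes at 1 absorbs one ∂, which compensates for the loss
    -- of one degree.
    Tame-vanishing : at1 c K.≈ K.0# → Tame ρ m (suc d) F →
      Tame ρ (suc m) d (λ a → c ⊗ F a)
    Tame-vanishing {c = c} c≈0 Ft = step
      (Polynomial≤-cong (λ _ → K.trans (K.*-congʳ c≈0) (K.zeroˡ _)) (Polynomial≤-const K.0#))
      λ k → Tame-⊕ (Tame-scale (∂ k c) Ft) (second k Ft)
      where
      Sc≈0 : ∀ k → at1 (S k c) K.≈ K.0#
      Sc≈0 k = K.trans (K.reflexive (at1-S k c)) c≈0

      -- In the second Leibniz term the factor `S k c` still vanishes at 1. For m = 0 only the value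
      -- counts, and it is 0; otherwise the gain from `S k c` offsets the loss in passing to
      -- `∂ k F`.
      second : ∀ {m d F} k → Tame ρ m (suc d) F →
        Tame ρ m (suc d) (λ a → S k c ⊗ ∂ k (F a))
      second k (value v)  = value (Polynomial≤-cong
        (λ _ → K.trans (K.*-congʳ (Sc≈0 k)) (K.zeroˡ _)) (Polynomial≤-const K.0#))
      second k (step _ s) = Tame-vanishing (Sc≈0 k) (s k)

    -- The correction to F is `∂ k F`, which is tame for words shorter by one and degree higher by
    -- one, times z_{k+1} - z_k, which vanishes at 1; `Tame-vanishing` restores both bounds.
    Tame-S : ∀ k → Tame ρ m d F → Tame ρ m d (S k ∘ F)
    Tame-S {F = F} k (value v)     =
      value (Polynomial≤-cong (λ a → K.reflexive (at1-S k (F a))) v)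
    Tame-S {F = F} k Ft@(step _ s) = Tame-cong (λ a → S≋id+Δ∂ k (F a))
      (Tame-⊕ Ft (Tame-vanishing (K.-‿inverseʳ K.1#) (s k)))

    -- In each Leibniz term `∂` hits only one factor, so a letter of the word raises the sum of the
    -- two bounds by one, not two.
    Tame-⊗ : Tame ρ m d F → Tame ρ m e G → Tame ρ m (d ℕ.+ e) (λ a → F a ⊗ G a)
    Tame-⊗ (value v)               (value w)     = value (Polynomial≤-* v w)
    Tame-⊗ {d = d} {e = e} Ft@(step v s) Gt@(step w t) = step (Polynomial≤-* v w) λ k → Tame-⊕
      (Tame-⊗ (s k) (Tame-pred Gt))
      -- Here the letter is charged to G, so the bound arises as `d + suc e` instead of
      -- `suc (d + e)`.
      (Tame-mono (ℕ.≤-reflexive (ℕ.+-suc d e))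
        (Tame-⊗ (Tame-S k (Tame-pred Ft)) (t k)))

    -- With bound 0 for each factor, the bound does not grow with the number of factors.
    Tame-∏ : ∀ {n} (F : Fin n → A → Polyz N) → (∀ i → Tame ρ m 0 (F i)) →
      Tame ρ m 0 (λ a → CommutativeMonoidSum.sum P.*-commutativeMonoid (λ i → F i a))
    Tame-∏ {n = zero}  F Ft = Tame-const P.1#
    Tame-∏ {n = suc n} F Ft = Tame-⊗ (Ft zero) (Tame-∏ (F ∘ suc) (Ft ∘ suc))

    Tame-D : ∀ k → Tame ρ (suc m) d F → Tame ρ m (suc d) (D k ∘ F)
    Tame-D k (step _ s) = Tame-scale _ (s k)

    -- Each `D` uses up one letter of the admissible word length, so tameness is carried for all
    -- `r`, and the recursive call asks for `suc r`.
    Tame-foldr-D : (∀ r → Tame ρ r 0 F) → (i : Vec (Fin N) m) →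
      ∀ r → Tame ρ r m (λ a → foldr′ D (F a) i)
    Tame-foldr-D Ft []      r = Ft r
    Tame-foldr-D Ft (k ∷ i) r = Tame-D k (Tame-foldr-D Ft i (suc r))

  -- Tameness of powers and of the product `P`.

  module _
    (1/[q-q⁻¹]-inverse : 1/[q-q⁻¹] K.* (q K.- q⁻¹) K.≈ K.1#)
    (1/suc : ℕ → K.Carrier)
    (1/suc-inverse : ∀ n → 1/suc n K.* fromℕ (suc n) K.≈ K.1#)
    where

    -- The absorption identity, now with genuine subtraction and with division by t+1: C(n,t+1)
    -- arises from C(n,t) by a factor linear in n.
    fromℕ-C-suc : ∀ n t → fromℕ (n C suc t) K.≈
      1/suc t K.* ((fromℕ n K.+ K.- fromℕ t) K.* fromℕ (n C t))
    fromℕ-C-suc n t = K.sym (begin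
      1/suc t K.* ((fromℕ n K.+ K.- fromℕ t) K.* b)   ≈⟨ K.*-congˡ difference ⟩
      1/suc t K.* (fromℕ (suc t) K.* c)               ≈⟨ K.*-assoc _ _ _ ⟨
      (1/suc t K.* fromℕ (suc t)) K.* c               ≈⟨ K.*-congʳ (1/suc-inverse t) ⟩
      K.1# K.* c                                      ≈⟨ K.*-identityˡ _ ⟩
      c                                               ∎)
      where
      open SetoidReasoning K.setoid
      open RingProperties K.ring using (-‿distribˡ-*)
      b = fromℕ (n C t)
      c = fromℕ (n C suc t)
      absorption : fromℕ n K.* b K.≈ fromℕ (suc t) K.* c K.+ fromℕ t K.* b
      absorption = begin
        fromℕ n K.* b                                     ≈⟨ fromℕ-* n (n C t) ⟨
        fromℕ (n * (n C t))
          ≡⟨ ≡.cong fromℕ ([1+k]*nC[1+k]+k*nCk≡n*nCk n t) ⟨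
        fromℕ (suc t * (n C suc t) ℕ.+ t * (n C t))
          ≈⟨ fromℕ-+ (suc t * (n C suc t)) (t * (n C t)) ⟩
        fromℕ (suc t * (n C suc t)) K.+ fromℕ (t * (n C t))
          ≈⟨ K.+-cong (fromℕ-* (suc t) (n C suc t)) (fromℕ-* t (n C t)) ⟩
        fromℕ (suc t) K.* c K.+ fromℕ t K.* b             ∎
      difference : (fromℕ n K.+ K.- fromℕ t) K.* b K.≈ fromℕ (suc t) K.* c
      difference = begin
        (fromℕ n K.+ K.- fromℕ t) K.* b                   ≈⟨ K.distribʳ _ _ _ ⟩
        fromℕ n K.* b K.+ (K.- fromℕ t) K.* b
          ≈⟨ K.+-cong absorption (K.sym (-‿distribˡ-* _ _)) ⟩
        (fromℕ (suc t) K.* c K.+ fromℕ t K.* b) K.- (fromℕ t K.* b)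
          ≈⟨ K.+-assoc _ _ _ ⟩
        fromℕ (suc t) K.* c K.+ (fromℕ t K.* b K.- (fromℕ t K.* b))
          ≈⟨ K.+-congˡ (K.-‿inverseʳ _) ⟩
        fromℕ (suc t) K.* c K.+ K.0#                      ≈⟨ K.+-identityʳ _ ⟩
        fromℕ (suc t) K.* c                               ∎

    module _ {A X : Set} {ρ : A → X → K.Carrier}
             (n : A → ℕ) (n≤1 : Polynomial≤ ρ 1 (fromℕ ∘ n)) where

      Polynomial≤-C : ∀ t → Polynomial≤ ρ t (λ a → fromℕ (n a C t))
      Polynomial≤-C zero    = Polynomial≤-const _
      Polynomial≤-C (suc t) = Polynomial≤-cong (λ a → fromℕ-C-suc (n a) t)
        -- The scalar must count with degree 0, so that the total is 0 + (1 + t).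
        (Polynomial≤-* (Polynomial≤-const {d = 0} (1/suc t))
          (Polynomial≤-* (Polynomial≤-+ n≤1 (Polynomial≤-const _)) (Polynomial≤-C t)))

      module _ {N : ℕ} (u : Polyz N) (u≈1 : at1 u K.≈ K.1#) where

        u-1≈0 : at1 u K.- K.1# K.≈ K.0#
        u-1≈0 = K.trans (K.+-congʳ u≈1) (K.-‿inverseʳ _)

        -- Induction on the word length `m`, with `t` growing as `m` shrinks: the term split off has
        -- degree t, and the factor u - 1 before the next tail pays for its bound t+1. For m = 0
        -- only C(n,t) survives at z = 1.
        Tame-tail : ∀ m t → Tame ρ m t (λ a → tail u t (n a))
        Tame-tail zero    t = value (Polynomial≤-cong
          (λ a → K.trans (eval-cong _ (tail-expand u t (n a)))
            (K.trans (K.+-congˡ (K.trans (K.*-congʳ u-1≈0) (K.zeroˡ _)))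
              (K.+-identityʳ _)))
          (Polynomial≤-C t))
        Tame-tail (suc m) t = Tame-cong (λ a → tail-expand u t (n a))
          (Tame-⊕ (Tame-scalar (Polynomial≤-C t))
                  (Tame-vanishing u-1≈0 (Tame-tail m (suc t))))

    Exponents : ℕ → Set
    Exponents N = (OffDiagonal N → ℕ) × (Fin N → ℕ) × (Fin N → ℕ)

    values : ∀ {N} → Exponents N → Parameter N → K.Carrier
    values (α , β , γ) = parameters α β γ

    -- At z = 1 each of `f`, `g`, `h` equals (q - q⁻¹)/(q - q⁻¹) = 1. `Tame-tail` applies with t =
    -- 0, since `tail u 0 n` is `u ^ n` by definition.
    Tame-P : ∀ {N} m → Tame (values {N}) m 0 (λ (α , β , γ) → P α β γ)
    Tame-P {N} m = Tame-⊗
      (Tame-∏ _ λ i → Tame-∏ _ λ j → Tame-f-power i j)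
      (Tame-∏ _ λ i → Tame-⊗
        (Tame-tail (λ (α , β , γ) → β i) (Polynomial≤-var (inj₂ (inj₁ i))) (g i)
          (K.trans (K.*-congˡ (K.+-congˡ (K.-‿cong (K.*-identityʳ _))))
            1/[q-q⁻¹]-inverse) m 0)
        (Tame-tail (λ (α , β , γ) → γ i) (Polynomial≤-var (inj₂ (inj₂ i))) (h i)
          (K.trans (K.*-congˡ (K.+-congʳ (K.*-identityʳ _))) 1/[q-q⁻¹]-inverse) m 0))
      where
      Tame-f-power : ∀ i j → Tame (values {N}) m 0 (λ (α , β , γ) → f-power α i j)
      Tame-f-power i j with i Fin.≟ j
      ... | yes _  = Tame-const _
      ... | no i≢j = Tame-tail (λ (α , β , γ) → α (pair i j i≢j))
        (Polynomial≤-var (inj₁ (pair i j i≢j))) (f i j)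
        (K.trans (K.*-congˡ (K.+-cong (K.*-identityʳ _) (K.-‿cong (K.*-identityʳ _))))
          1/[q-q⁻¹]-inverse) m 0

    foldr-D-P-polynomial : ∀ {N m} (i : Vec (Fin N) m) →
      Σ[ Q ∈ Poly (Parameter N) ]
        (TotalDegree≤ m Q ×
         (∀ α β γ → at1 (foldr′ D (P α β γ) i) K.≈ eval (parameters α β γ) Q))
    foldr-D-P-polynomial i with Tame-at1 (Tame-foldr-D Tame-P i 0)
    ... | polynomial Q deg eq = Q , deg , λ α β γ → eq (α , β , γ)

-- Inverses of positive integers in ℚ(q).

open import Defs
open CommutativeRing ℚ⟨q⟩-ring using (_≈_; 1#)

private module F = CommutativeRing ℚ⟨q⟩-ring

constant : ℚ → F.Carrier
constant a = ℚ⟨q⟩.ι (a ∷ [])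

constant-+ : ∀ a b → constant (a ℚ.+ b) F.≈ constant a F.+ constant b
constant-+ a b = ℚ⟨q⟩.cross (R.*-cong
  {a ℚ.+ b ∷ []} {(a ∷ []) R.* R.1# R.+ (b ∷ []) R.* R.1#} {R.1# R.* R.1#} {R.1#}
  (R.sym (R.+-cong (R.*-identityʳ (a ∷ [])) (R.*-identityʳ (b ∷ []))))
  (R.*-identityˡ R.1#))
  where module R = CommutativeRing ℚ[q].commutativeRing

constant-* : ∀ a b → constant (a ℚ.* b) F.≈ constant a F.* constant b
constant-* a b = ℚ⟨q⟩.cross (R.*-cong
  {a ℚ.* b ∷ []} {(a ∷ []) R.* (b ∷ [])} {R.1# R.* R.1#} {R.1#}
  (ℚ[q].coeffs λ { zero → ≡.sym (ℚ.+-identityʳ _) ; (suc n) → ≡.refl })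
  (R.*-identityˡ R.1#))
  where module R = CommutativeRing ℚ[q].commutativeRing

fromℕ-ℚ : ℕ → ℚ
fromℕ-ℚ n = n · 1ℚ
  where open RawMonoid ℚ.+-0-rawMonoid using () renaming (_×_ to _·_)

constant-fromℕ : ∀ n → constant (fromℕ-ℚ n) F.≈ fromℕ n
-- The numerators `0ℚ ∷ []` and `[]` differ as lists but have the same coefficients.
constant-fromℕ zero    = ℚ⟨q⟩.cross (ℚ[q].coeffs λ { zero → ≡.refl ; (suc n) → ≡.refl })
constant-fromℕ (suc n) =
  F.trans (constant-+ 1ℚ (fromℕ-ℚ n)) (F.+-congˡ {F.1#} (constant-fromℕ n))

fromℕ-ℚ-nonNeg : ∀ n → ℚ.NonNegative (fromℕ-ℚ n)
fromℕ-ℚ-nonNeg zero    = _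
fromℕ-ℚ-nonNeg (suc n) = ℚ.nonNeg+nonNeg⇒nonNeg 1ℚ (fromℕ-ℚ n) {{fromℕ-ℚ-nonNeg n}}

-- The inverse is taken in ℚ, where the order shows that n+1 is nonzero: it is 1 plus a nonnegative
-- number.
ℚ-1/suc : ∀ n → Σ[ r ∈ ℚ ] r ℚ.* fromℕ-ℚ (suc n) ≡ 1ℚ
ℚ-1/suc n = ℚ.1/ fromℕ-ℚ (suc n) , ℚ.*-inverseˡ (fromℕ-ℚ (suc n))
  where
  instance
    nonNeg : ℚ.NonNegative (fromℕ-ℚ n)
    nonNeg = fromℕ-ℚ-nonNeg n
    pos : ℚ.Positive (fromℕ-ℚ (suc n))
    pos = ℚ.pos+nonNeg⇒pos 1ℚ (fromℕ-ℚ n)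
    nonZero : ℚ.NonZero (fromℕ-ℚ (suc n))
    nonZero = ℚ.pos⇒nonZero (fromℕ-ℚ (suc n))

1/suc : ℕ → F.Carrier
1/suc n = constant (proj₁ (ℚ-1/suc n))

1/suc-inverse : ∀ n → 1/suc n F.* fromℕ (suc n) F.≈ F.1#
1/suc-inverse n = begin
  1/suc n F.* fromℕ (suc n)
    ≈⟨ F.*-congˡ {1/suc n} (constant-fromℕ (suc n)) ⟨
  1/suc n F.* constant (fromℕ-ℚ (suc n))
    ≈⟨ constant-* (proj₁ (ℚ-1/suc n)) (fromℕ-ℚ (suc n)) ⟨
  constant (proj₁ (ℚ-1/suc n) ℚ.* fromℕ-ℚ (suc n))
    ≡⟨ ≡.cong constant (proj₂ (ℚ-1/suc n)) ⟩
  F.1# ∎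
  where open SetoidReasoning F.setoid

1/[q-q⁻¹]-inverse : 1/[q-q⁻¹] F.* (q F.- q⁻¹) F.≈ F.1#
1/[q-q⁻¹]-inverse = F.trans (F.*-comm 1/[q-q⁻¹] (q F.- q⁻¹))
  (ℚ⟨q⟩.recip-inverse (q F.- q⁻¹) q-q⁻¹≉0)

lemma19 : (n m : ℕ) → 1 ≤ n → (i : Vec (Fin (2 * n)) m) →
    Σ[ Q ∈ Poly (Parameter (2 * n)) ]
    (TotalDegree≤ m Q ×
    ((α : OffDiagonal (2 * n) → ℕ) (β γ : Fin (2 * n) → ℕ) →
    eval (λ _ → 1#) (foldr′ D (P α β γ) i) ≈ eval (parameters α β γ) Q))
lemma19 _ _ _ = TameFamilies.foldr-D-P-polynomial ℚ⟨q⟩-ring q q⁻¹ 1/[q-q⁻¹]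
  1/[q-q⁻¹]-inverse 1/suc 1/suc-inverse
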